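{- For every (not necessarily optimal) $(7,2)$-generator $\mathcal G$, $|\mathcal G^i|\ge \mathrm{constr}^i(7,2)$ for all $i=1,2,3,4$. Moreover, $\mathrm{Constr}(7,2)$ is the unique optimal $(7,2)$-generator, i.e. every optimal $(7,2)$-generator is of the form $(\mathcal P(V_1)\cup\mathcal P(V_2))\setminus\{\emptyset\}$ for some partition $\{V_1,V_2\}$ of $[7]$ with $|V_1|=3$, $|V_2|=4$, and all these families are optimal.
   Context: $[n]=\{1,\dots,n\}$. An $(n,k)$-generator is a family $\mathcal G$ of subsets of $[n]$ such that every non-empty subset of $[n]$ is a disjoint union of at most $k$ members of $\mathcal G$; it is optimal if $|\mathcal G|$ is minimum among all $(n,k)$-generators. $\mathrm{Constr}(7,2):=(\mathcal P(V_1)\cup\mathcal P(V_2))\setminus\{\emptyset\}$ where $\{V_1,V_2\}$ is an arbitrary partition of $[7]$ into a set of size $3$ and a set of size $4$ (so $|\mathrm{Constr}(7,2)|=22$). For a family $\mathcal G$ of sets, $\mathcal G^i:=\{g\in\mathcal G:|g|\ge i\}$, and $\mathrm{constr}^i(7,2):=|\{g\in\mathrm{Constr}(7,2):|g|\ge i\}|$. -}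

module Defs where

open import Data.Bool.Base using (Bool; T; _∧_; _∨_)
open import Data.Fin.Subset
  using (Subset; inside; outside; ⊤; _∩_; _∪_; ⋃; ∣_∣; Nonempty; Empty)
open import Data.Fin.Subset.Properties using (_⊆?_; nonempty?)
open import Data.List.Base using (List; []; _∷_; _++_; map; length; filterᵇ)
open import Data.List.Relation.Unary.All using (All)
open import Data.List.Relation.Unary.AllPairs using (AllPairs)
open import Data.Nat.Base using (ℕ; zero; suc; _≤_; _≤ᵇ_)
open import Data.Product.Base using (_×_; ∃-syntax)
import Data.Vec.Base as Vec
open import Relation.Binary.PropositionalEquality.Core using (_≡_)
open import Relation.Nullary.Decidable.Core using (does)

-- The ground set [n] is Fin n.  A family of subsets of [n] is given by its
-- characteristic function, so families are compared pointwise (_≗_).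

Family : ℕ → Set
Family n = Subset n → Bool

infix 4 _∈ᶠ_

_∈ᶠ_ : ∀ {n} → Subset n → Family n → Set
g ∈ᶠ 𝒢 = T (𝒢 g)

-- Each subset of [n] occurs exactly once.

subsets : ∀ n → List (Subset n)
subsets zero    = Vec.[] ∷ []
subsets (suc n) = map (inside Vec.∷_) (subsets n) ++ map (outside Vec.∷_) (subsets n)

card : ∀ {n} → Family n → ℕ
card {n} 𝒢 = length (filterᵇ 𝒢 (subsets n))

-- 𝒢 ^≥ i is { g ∈ 𝒢 : |g| ≥ i }.

infixl 8 _^≥_

_^≥_ : ∀ {n} → Family n → ℕ → Family n
(𝒢 ^≥ i) g = 𝒢 g ∧ (i ≤ᵇ ∣ g ∣)

Disjoint : ∀ {n} → Subset n → Subset n → Set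
Disjoint p q = Empty (p ∩ q)

-- A list satisfying AllPairs Disjoint can repeat no member except ∅, and
-- dropping copies of ∅ changes neither the union nor the bound k.

DisjointUnionOf≤ : ∀ {n} → ℕ → Family n → Subset n → Set
DisjointUnionOf≤ k 𝒢 s =
  ∃[ gs ] length gs ≤ k × All (_∈ᶠ 𝒢) gs × AllPairs Disjoint gs × ⋃ gs ≡ s

IsGenerator : ∀ n → ℕ → Family n → Set
IsGenerator n k 𝒢 = (s : Subset n) → Nonempty s → DisjointUnionOf≤ k 𝒢 s

IsOptimalGenerator : ∀ n → ℕ → Family n → Set
IsOptimalGenerator n k 𝒢 =
  IsGenerator n k 𝒢 × (∀ ℋ → IsGenerator n k ℋ → card 𝒢 ≤ card ℋ)

IsPartition₃₄ : Subset 7 → Subset 7 → Set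
IsPartition₃₄ V₁ V₂ =
  Disjoint V₁ V₂ × V₁ ∪ V₂ ≡ ⊤ × ∣ V₁ ∣ ≡ 3 × ∣ V₂ ∣ ≡ 4

𝒫 : ∀ {n} → Subset n → Family n
𝒫 V g = does (g ⊆? V)

Constr : ∀ {n} → Subset n → Subset n → Family n
Constr V₁ V₂ g = (𝒫 V₁ g ∨ 𝒫 V₂ g) ∧ does (nonempty? g)

{-# OPTIONS --safe #-}

-- With ∅ adjoined to a generator 𝒢, every subset is the disjoint union of exactly two
-- members.  So, whatever is known about membership in 𝒢, each set s yields a clause: a list
-- of sets, one part from every split of s that is still possible, at least one of which is a
-- member.  Counting clauses with multiplicities bounds |𝒢ⁱ| from below.  A case distinction
-- on membership, in which a case is closed by such a bound or because a renaming of the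
-- ground set turns it into a special case of a settled one, gives |𝒢³| ≥ 6, and shows that
-- |𝒢²| ≤ 15 forces 𝒢 to contain some Constr V₁ V₂.  The seven singletons are all members,
-- so |𝒢¹| ≥ |𝒢²| + 7, which leaves no room for another optimal generator.
-- The case distinctions (lemmas₃ and lemmas₂) were found by a computer search.

module Submission where

open import Defs
open import Data.Bool.Base using (Bool; true; false; T; not; _∧_; _∨_; if_then_else_)
open import Data.Bool.ListAction using (all)
open import Data.Bool.Properties using (T-∧; T-∨; T-≡; ∧-identityʳ; ∧-zeroʳ; ∨-zeroʳ; ∨-identityʳ)
open import Data.Empty using (⊥-elim) renaming (⊥ to False)
open import Data.Fin.Subset as Subset
  using (Subset; inside; outside; ⊥; ⊤; _∩_; _∪_; ∣_∣; Nonempty; Empty; _⊆_)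
open import Data.Fin.Subset.Properties
open import Data.List.Base
  using (List; []; _∷_; _++_; map; length; filterᵇ; mapMaybe; foldr; upTo)
open import Data.List.Membership.Propositional using (_∈_)
open import Data.List.Membership.Propositional.Properties
  using (∈-map⁺; ∈-++⁺ˡ; ∈-++⁺ʳ; ∈-upTo⁺)
open import Data.List.Relation.Unary.All using (All; []; _∷_)
open import Data.List.Relation.Unary.AllPairs using ([]; _∷_)
open import Data.List.Relation.Unary.Any using (Any; here; there)
open import Data.Maybe.Base using (Maybe; just; nothing; maybe′)
open import Data.Nat.Base
open import Data.Nat.DivMod using (_/_; _%_)
open import Data.Nat.Properties
open import Data.Product.Base as Product using (∃-syntax; _×_; _,_; proj₁; proj₂)
open import Data.Sum.Base as Sum using (_⊎_; inj₁; inj₂; [_,_]′)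
open import Data.Unit.Base using (tt) renaming (⊤ to Unit)
open import Data.Vec.Base using ([]; _∷_; replicate; zipWith)
open import Data.Vec.Properties using (∷-injectiveʳ)
open import Function.Base using (_∘_)
open import Function.Bundles using (Equivalence)
open import Relation.Binary.PropositionalEquality
open import Relation.Nullary using (¬_; ¬?; Dec; does; yes; no; contradiction)
open import Algebra.Properties.CommutativeSemigroup +-commutativeSemigroup
  using (interchange; x∙yz≈y∙xz)
open Equivalence using (to; from)

private variable
  A B : Set
  n : ℕ

-- Adjacent transpositions of the ground set

swap : ℕ → Subset n → Subset n
swap _       []          = []
swap zero    (x ∷ [])    = x ∷ []
swap zero    (x ∷ y ∷ s) = y ∷ x ∷ s
swap (suc k) (x ∷ s)     = x ∷ swap k s

swaps : List ℕ → Subset n → Subset n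
swaps []      s = s
swaps (k ∷ π) s = swap k (swaps π s)

swap-involutive : ∀ k (s : Subset n) → swap k (swap k s) ≡ s
swap-involutive zero    []          = refl
swap-involutive (suc k) []          = refl
swap-involutive zero    (x ∷ [])    = refl
swap-involutive zero    (x ∷ y ∷ s) = refl
swap-involutive (suc k) (x ∷ s)     = cong (x ∷_) (swap-involutive k s)

-- An arbitrary Boolean operation covers `_∩_` and `_∪_` at once; `swap-replicate` likewise covers
-- `⊥` and `⊤`.
swap-zipWith : ∀ (f : Bool → Bool → Bool) k (s t : Subset n) →
               swap k (zipWith f s t) ≡ zipWith f (swap k s) (swap k t)
swap-zipWith f zero    []          []          = refl
swap-zipWith f (suc k) []          []          = refl
swap-zipWith f zero    (x ∷ [])    (y ∷ [])    = refl
swap-zipWith f zero    (_ ∷ _ ∷ _) (_ ∷ _ ∷ _) = refl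
swap-zipWith f (suc k) (x ∷ s)     (y ∷ t)     = cong (_ ∷_) (swap-zipWith f k s t)

swap-replicate : ∀ k n x → swap k (replicate n x) ≡ replicate n x
swap-replicate zero    zero          x = refl
swap-replicate (suc k) zero          x = refl
swap-replicate zero    (suc zero)    x = refl
swap-replicate zero    (suc (suc n)) x = refl
swap-replicate (suc k) (suc n)       x = cong (x ∷_) (swap-replicate k n x)

∣swap∣ : ∀ k (s : Subset n) → ∣ swap k s ∣ ≡ ∣ s ∣
∣swap∣ zero    []                      = refl
∣swap∣ (suc k) []                      = refl
∣swap∣ zero    (x ∷ [])                = refl
∣swap∣ zero    (inside  ∷ inside  ∷ s) = refl
∣swap∣ zero    (inside  ∷ outside ∷ s) = refl
∣swap∣ zero    (outside ∷ inside  ∷ s) = refl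
∣swap∣ zero    (outside ∷ outside ∷ s) = refl
∣swap∣ (suc k) (inside  ∷ s)           = cong suc (∣swap∣ k s)
∣swap∣ (suc k) (outside ∷ s)           = ∣swap∣ k s

-- Functions on the subsets of [n], stored as binary trees

data Trie (A : Set) : ℕ → Set where
  leaf : A → Trie A zero
  node : Trie A n → Trie A n → Trie A (suc n)

lookup : Trie A n → Subset n → A
lookup (leaf x)   []            = x
lookup (node l r) (inside  ∷ s) = lookup l s
lookup (node l r) (outside ∷ s) = lookup r s

update : Subset n → (A → A) → Trie A n → Trie A n
update []            f (leaf x)   = leaf (f x)
update (inside  ∷ s) f (node l r) = node (update s f l) r
update (outside ∷ s) f (node l r) = node l (update s f r)

zipTrie : {C : Set} → (A → B → C) → Trie A n → Trie B n → Trie C n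
zipTrie f (leaf x)   (leaf y)     = leaf (f x y)
zipTrie f (node l r) (node l′ r′) = node (zipTrie f l l′) (zipTrie f r r′)

mapTrie : (A → B) → Trie A n → Trie B n
mapTrie f (leaf x)   = leaf (f x)
mapTrie f (node l r) = node (mapTrie f l) (mapTrie f r)

all₂ : (A → B → Bool) → Trie A n → Trie B n → Bool
all₂ p (leaf x)   (leaf y)     = p x y
all₂ p (node l r) (node l′ r′) = all₂ p l l′ ∧ all₂ p r r′

all₂-lookup : ∀ (p : A → B → Bool) (t : Trie A n) u → T (all₂ p t u) →
              ∀ s → T (p (lookup t s) (lookup u s))
all₂-lookup p (leaf x)   (leaf y)     h []            = h
all₂-lookup p (node l r) (node l′ r′) h (inside  ∷ s) =
  all₂-lookup p l l′ (proj₁ (to T-∧ h)) s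
all₂-lookup p (node l r) (node l′ r′) h (outside ∷ s) =
  all₂-lookup p r r′ (proj₂ (to (T-∧ {all₂ p l l′}) h)) s

swapTrie : ℕ → Trie A n → Trie A n
swapTrie _       (leaf x)                     = leaf x
swapTrie zero    (node (node a b) (node c d)) = node (node a c) (node b d)
swapTrie zero    (node (leaf x) (leaf y))     = node (leaf x) (leaf y)
swapTrie (suc k) (node l r)                   = node (swapTrie k l) (swapTrie k r)

lookup-swapTrie : ∀ k (t : Trie A n) s → lookup (swapTrie k t) s ≡ lookup t (swap k s)
lookup-swapTrie zero    (leaf x)                     []                      = refl
lookup-swapTrie (suc k) (leaf x)                     []                      = refl
lookup-swapTrie zero    (node (node a b) (node c d)) (inside  ∷ inside  ∷ s) = refl
lookup-swapTrie zero    (node (node a b) (node c d)) (inside  ∷ outside ∷ s) = refl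
lookup-swapTrie zero    (node (node a b) (node c d)) (outside ∷ inside  ∷ s) = refl
lookup-swapTrie zero    (node (node a b) (node c d)) (outside ∷ outside ∷ s) = refl
lookup-swapTrie zero    (node (leaf x) (leaf y))     (inside  ∷ [])          = refl
lookup-swapTrie zero    (node (leaf x) (leaf y))     (outside ∷ [])          = refl
lookup-swapTrie (suc k) (node l r)                   (inside  ∷ s)           = lookup-swapTrie k l s
lookup-swapTrie (suc k) (node l r)                   (outside ∷ s)           = lookup-swapTrie k r s

-- Precomposition reverses the order: `swaps` applies the head of the list last, so the head acts on
-- the trie first.
swapsTrie : List ℕ → Trie A n → Trie A n
swapsTrie []      t = t
swapsTrie (k ∷ π) t = swapsTrie π (swapTrie k t)

lookup-swapsTrie : ∀ π (t : Trie A n) s → lookup (swapsTrie π t) s ≡ lookup t (swaps π s)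
lookup-swapsTrie []      t s = refl
lookup-swapsTrie (k ∷ π) t s =
  trans (lookup-swapsTrie π (swapTrie k t) s) (lookup-swapTrie k t (swaps π s))

-- Weighted counting of families

weigh : Trie ℕ n → Family n → ℕ
weigh (leaf w)   𝒢 = if 𝒢 [] then w else 0
weigh (node l r) 𝒢 = weigh l (𝒢 ∘ (inside ∷_)) + weigh r (𝒢 ∘ (outside ∷_))

mass : Trie ℕ n → ℕ
mass (leaf w)   = w
mass (node l r) = mass l + mass r

-- The indicator of the sets with at least `i` elements. Each chosen element lowers the threshold
-- for the rest by one, and `pred` keeps a threshold that is already met at 0.
large : ∀ {n} → ℕ → Trie ℕ n
large {zero}  zero    = leaf 1
large {zero}  (suc i) = leaf 0
large {suc n} i       = node (large (pred i)) (large i)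

weigh-mono : ∀ (t u : Trie ℕ n) → T (all₂ _≤ᵇ_ t u) → ∀ 𝒢 → weigh t 𝒢 ≤ weigh u 𝒢
weigh-mono (leaf w)   (leaf v)     h 𝒢 with 𝒢 []
... | true  = ≤ᵇ⇒≤ w v h
... | false = ≤-refl
weigh-mono (node l r) (node l′ r′) h 𝒢 =
  +-mono-≤ (weigh-mono l l′ (proj₁ (to T-∧ h)) _)
           (weigh-mono r r′ (proj₂ (to (T-∧ {all₂ _≤ᵇ_ l l′}) h)) _)

weigh-+ : ∀ (t u : Trie ℕ n) 𝒢 → weigh (zipTrie _+_ t u) 𝒢 ≡ weigh t 𝒢 + weigh u 𝒢
weigh-+ (leaf w)   (leaf v)     𝒢 with 𝒢 []
... | true  = refl
... | false = refl
weigh-+ (node l r) (node l′ r′) 𝒢 =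
  trans (cong₂ _+_ (weigh-+ l l′ _) (weigh-+ r r′ _))
        (interchange (weigh l _) (weigh l′ _) (weigh r _) (weigh r′ _))

-- With respect to the first two elements, both mixed quadrants of `large i` carry `large (pred i)`,
-- so exchanging them only reorders four summands.
weigh-swap : ∀ k i (𝒢 : Family n) → weigh (large i) (𝒢 ∘ swap k) ≡ weigh (large i) 𝒢
weigh-swap {zero}        zero    zero          𝒢 = refl
weigh-swap {zero}        zero    (suc i)       𝒢 = refl
weigh-swap {zero}        (suc k) zero          𝒢 = refl
weigh-swap {zero}        (suc k) (suc i)       𝒢 = refl
weigh-swap {suc zero}    zero    zero          𝒢 = refl
weigh-swap {suc zero}    zero    (suc zero)    𝒢 = refl
weigh-swap {suc zero}    zero    (suc (suc i)) 𝒢 = refl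
weigh-swap {suc (suc n)} zero    i             𝒢 =
  interchange (weigh {n} (large (pred (pred i))) _) (weigh {n} (large (pred i)) _)
              (weigh {n} (large (pred i)) _) (weigh {n} (large i) _)
weigh-swap {suc n}       (suc k) i             𝒢 =
  cong₂ _+_ (weigh-swap k (pred i) (𝒢 ∘ (inside ∷_))) (weigh-swap k i (𝒢 ∘ (outside ∷_)))

weigh-update : ∀ s (t : Trie ℕ n) 𝒢 →
               weigh (update s suc t) 𝒢 ≡ (if 𝒢 s then 1 else 0) + weigh t 𝒢
weigh-update []            (leaf w)   𝒢 with 𝒢 []
... | true  = refl
... | false = refl
weigh-update (inside  ∷ s) (node l r) 𝒢 =
  trans (cong (_+ _) (weigh-update s l _)) (+-assoc (if 𝒢 (inside ∷ s) then 1 else 0) _ _)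
weigh-update (outside ∷ s) (node l r) 𝒢 = begin
  weigh l _ + weigh (update s suc r) _ ≡⟨ cong (weigh l _ +_) (weigh-update s r _) ⟩
  weigh l _ + (c + weigh r _)          ≡⟨ x∙yz≈y∙xz (weigh l _) c (weigh r _) ⟩
  c + (weigh l _ + weigh r _)          ∎
  where
  open ≡-Reasoning
  c = if 𝒢 (outside ∷ s) then 1 else 0

weigh-* : ∀ w (t : Trie ℕ n) 𝒢 → weigh (mapTrie (w *_) t) 𝒢 ≡ w * weigh t 𝒢
weigh-* w (leaf v)   𝒢 with 𝒢 []
... | true  = refl
... | false = sym (*-zeroʳ w)
weigh-* w (node l r) 𝒢 =
  trans (cong₂ _+_ (weigh-* w l _) (weigh-* w r _)) (sym (*-distribˡ-+ w (weigh l _) (weigh r _)))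

card-∷ : (𝒢 : Family (suc n)) → card 𝒢 ≡ card (𝒢 ∘ (inside ∷_)) + card (𝒢 ∘ (outside ∷_))
card-∷ {n} 𝒢 = trans (count-++ (map (inside ∷_) (subsets n)) _)
                     (cong₂ _+_ (count-map (subsets n)) (count-map (subsets n)))
  where
  count-++ : ∀ xs ys → length (filterᵇ 𝒢 (xs ++ ys)) ≡
             length (filterᵇ 𝒢 xs) + length (filterᵇ 𝒢 ys)
  count-++ []       ys = refl
  count-++ (x ∷ xs) ys with 𝒢 x
  ... | true  = cong suc (count-++ xs ys)
  ... | false = count-++ xs ys

  count-map : ∀ {b} xs → length (filterᵇ 𝒢 (map (b ∷_) xs)) ≡ length (filterᵇ (𝒢 ∘ (b ∷_)) xs)
  count-map     []       = refl
  count-map {b} (x ∷ xs) with 𝒢 (b ∷ x)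
  ... | true  = cong suc (count-map xs)
  ... | false = count-map xs

card-cong : ∀ {n} {𝒢 ℋ : Family n} → 𝒢 ≗ ℋ → card 𝒢 ≡ card ℋ
card-cong {zero} {𝒢} {ℋ} h with 𝒢 [] | ℋ [] | h []
... | true  | _ | refl = refl
... | false | _ | refl = refl
card-cong {suc n} {𝒢} {ℋ} h = begin
  card 𝒢
    ≡⟨ card-∷ 𝒢 ⟩
  card (𝒢 ∘ (inside ∷_)) + card (𝒢 ∘ (outside ∷_))
    ≡⟨ cong₂ _+_ (card-cong (h ∘ (inside ∷_))) (card-cong (h ∘ (outside ∷_))) ⟩
  card (ℋ ∘ (inside ∷_)) + card (ℋ ∘ (outside ∷_))
    ≡⟨ sym (card-∷ ℋ) ⟩
  card ℋ ∎
  where open ≡-Reasoning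

-- Passes from the enumeration behind `card` to an additive function of tries, on which all later
-- bounds are computed.
card-^≥ : ∀ i (𝒢 : Family n) → card (𝒢 ^≥ i) ≡ weigh (large i) 𝒢
card-^≥ {zero} zero    𝒢 with 𝒢 []
... | true  = refl
... | false = refl
card-^≥ {zero} (suc i) 𝒢 with 𝒢 []
... | true  = refl
... | false = refl
card-^≥ {suc n} i 𝒢 =
  trans (card-∷ (𝒢 ^≥ i)) (cong₂ _+_ inside-part (card-^≥ i (𝒢 ∘ (outside ∷_))))
  where
  pred-≤ᵇ : ∀ i m → (i ≤ᵇ suc m) ≡ (pred i ≤ᵇ m)
  pred-≤ᵇ zero          m = refl
  pred-≤ᵇ (suc zero)    m = refl
  pred-≤ᵇ (suc (suc i)) m = refl

  inside-part = trans (card-cong (λ s → cong (𝒢 (inside ∷ s) ∧_) (pred-≤ᵇ i ∣ s ∣)))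
                      (card-^≥ (pred i) (𝒢 ∘ (inside ∷_)))

-- Splits into two disjoint members

-- Unlike in IsGenerator, exactly two parts are required; this costs nothing
-- once ∅ is a member.

Splits : Family n → Set
Splits 𝒢 = ∀ s → ∃[ a ] ∃[ b ] T (𝒢 a) × T (𝒢 b) × a ∩ b ≡ ⊥ × a ∪ b ≡ s

Splits-swap : ∀ k {𝒢 : Family n} → Splits 𝒢 → Splits (𝒢 ∘ swap k)
Splits-swap {n} k {𝒢} split s with split (swap k s)
... | a , b , a∈ , b∈ , a∩b≡⊥ , a∪b≡s =
  swap k a , swap k b ,
  subst (T ∘ 𝒢) (sym (swap-involutive k a)) a∈ ,
  subst (T ∘ 𝒢) (sym (swap-involutive k b)) b∈ ,
  trans (sym (swap-zipWith _ k a b)) (trans (cong (swap k) a∩b≡⊥) (swap-replicate k n _)) ,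
  trans (sym (swap-zipWith _ k a b)) (trans (cong (swap k) a∪b≡s) (swap-involutive k s))

-- halves s keeps only one of (a , b) and (b , a), lest two equal parts of the same split
-- both enter a clause.

splits halves : Subset n → List (Subset n × Subset n)
splits []            = ([] , []) ∷ []
splits (inside  ∷ s) = map (λ (a , b) → inside ∷ a , outside ∷ b) (splits s) ++
                       map (λ (a , b) → outside ∷ a , inside ∷ b) (splits s)
splits (outside ∷ s) = map (λ (a , b) → outside ∷ a , outside ∷ b) (splits s)

halves []            = ([] , []) ∷ []
halves (inside  ∷ s) = map (λ (a , b) → inside ∷ a , outside ∷ b) (splits s)
halves (outside ∷ s) = map (λ (a , b) → outside ∷ a , outside ∷ b) (halves s)

∈-splits : ∀ (a b : Subset n) → a ∩ b ≡ ⊥ → (a , b) ∈ splits (a ∪ b)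
∈-splits []            []            _ = here refl
∈-splits (inside  ∷ a) (inside  ∷ b) ()
∈-splits (inside  ∷ a) (outside ∷ b) h = ∈-++⁺ˡ (∈-map⁺ _ (∈-splits a b (∷-injectiveʳ h)))
∈-splits (outside ∷ a) (inside  ∷ b) h = ∈-++⁺ʳ _ (∈-map⁺ _ (∈-splits a b (∷-injectiveʳ h)))
∈-splits (outside ∷ a) (outside ∷ b) h = ∈-map⁺ _ (∈-splits a b (∷-injectiveʳ h))

-- `halves` retains the orientation whose first part contains the least element of the union, so
-- either order of the two parts may be the listed one.
∈-halves : ∀ (a b : Subset n) → a ∩ b ≡ ⊥ →
           (a , b) ∈ halves (a ∪ b) ⊎ (b , a) ∈ halves (a ∪ b)
∈-halves []            []            _ = inj₁ (here refl)
∈-halves (inside  ∷ a) (inside  ∷ b) ()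
∈-halves (inside  ∷ a) (outside ∷ b) h = inj₁ (∈-map⁺ _ (∈-splits a b (∷-injectiveʳ h)))
∈-halves (outside ∷ a) (inside  ∷ b) h =
  inj₂ (∈-map⁺ _ (subst (λ s → (b , a) ∈ splits s) (∪-comm b a)
    (∈-splits b a (trans (∩-comm b a) (∷-injectiveʳ h)))))
∈-halves (outside ∷ a) (outside ∷ b) h =
  Sum.map (∈-map⁺ _) (∈-map⁺ _) (∈-halves a b (∷-injectiveʳ h))

-- Partial knowledge of a family and the resulting clauses

-- nothing marks the subsets whose membership is undecided.

Assignment : ℕ → Set
Assignment = Trie (Maybe Bool)

Agrees : Maybe Bool → Bool → Set
Agrees nothing  _ = Unit
Agrees (just c) b = b ≡ c

infix 4 _⊨_ _⊑_

_⊨_ : Family n → Assignment n → Set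
𝒢 ⊨ σ = ∀ s → Agrees (lookup σ s) (𝒢 s)

assign : Bool → Subset n → Assignment n → Assignment n
assign b s = update s (λ _ → just b)

lookup-update : ∀ s (f : A → A) t (u : Subset n) →
                (u ≡ s × lookup (update s f t) u ≡ f (lookup t u)) ⊎
                lookup (update s f t) u ≡ lookup t u
lookup-update []            f (leaf x)   []            = inj₁ (refl , refl)
lookup-update (inside  ∷ s) f (node l r) (inside  ∷ u) =
  Sum.map₁ (Product.map₁ (cong _)) (lookup-update s f l u)
lookup-update (inside  ∷ s) f (node l r) (outside ∷ u) = inj₂ refl
lookup-update (outside ∷ s) f (node l r) (inside  ∷ u) = inj₂ refl
lookup-update (outside ∷ s) f (node l r) (outside ∷ u) =
  Sum.map₁ (Product.map₁ (cong _)) (lookup-update s f r u)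

⊨-assign : ∀ {𝒢 : Family n} {σ} s b → 𝒢 s ≡ b → 𝒢 ⊨ σ → 𝒢 ⊨ assign b s σ
⊨-assign {σ = σ} s b eq h u with lookup-update s (λ _ → just b) σ u
... | inj₁ (refl , e) = subst (λ m → Agrees m _) (sym e) eq
... | inj₂ e          = subst (λ m → Agrees m _) (sym e) (h u)

⊨-swaps : ∀ π {𝒢 : Family n} {σ} → 𝒢 ⊨ σ → 𝒢 ∘ swaps π ⊨ swapsTrie π σ
⊨-swaps π h s = subst (λ m → Agrees m _) (sym (lookup-swapsTrie π _ s)) (h (swaps π s))

weaker : Maybe Bool → Maybe Bool → Bool
weaker nothing      _            = true
weaker (just true)  (just true)  = true
weaker (just false) (just false) = true
weaker (just _)     _            = false

weaker-Agrees : ∀ m m′ {b} → T (weaker m m′) → Agrees m′ b → Agrees m b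
weaker-Agrees nothing      _            _ _ = _
weaker-Agrees (just true)  (just true)  _ h = h
weaker-Agrees (just false) (just false) _ h = h

_⊑_ : Assignment n → Assignment n → Bool
_⊑_ = all₂ weaker

-- Carries what is settled for `τ` over to its special cases: `σ` repeats every decision of `τ` and
-- may decide more.
⊑-⊨ : ∀ (τ σ : Assignment n) {𝒢} → T (τ ⊑ σ) → 𝒢 ⊨ σ → 𝒢 ⊨ τ
⊑-⊨ τ σ h g s = weaker-Agrees (lookup τ s) (lookup σ s) (all₂-lookup weaker τ σ h s) (g s)

-- Any choice of the part of an undecided split is sound; the larger one is needed for the
-- bounds on 𝒢 ^≥ i, which clauses containing sets smaller than i cannot contribute to.

pick : Maybe Bool → Maybe Bool → Subset n → Subset n → Maybe (Subset n)
pick (just false) _            a b = nothing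
pick (just true)  (just false) a b = nothing
pick nothing      (just false) a b = nothing
pick (just true)  _            a b = just b
pick nothing      (just true)  a b = just a
pick nothing      nothing      a b = just (if ∣ b ∣ ≤ᵇ ∣ a ∣ then a else b)

clause : Assignment n → Subset n → List (Subset n)
clause σ s = mapMaybe (λ (a , b) → pick (lookup σ a) (lookup σ b) a b) (halves s)

pick-member : ∀ (𝒢 : Family n) {m m′} a b → Agrees m (𝒢 a) → Agrees m′ (𝒢 b) →
              T (𝒢 a) → T (𝒢 b) → ∃[ c ] pick m m′ a b ≡ just c × T (𝒢 c)
pick-member 𝒢 {just false} {_}          a b h h′ ta tb = ⊥-elim (subst T h ta)
pick-member 𝒢 {just true}  {just false} a b h h′ ta tb = ⊥-elim (subst T h′ tb)
pick-member 𝒢 {nothing}    {just false} a b h h′ ta tb = ⊥-elim (subst T h′ tb)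
pick-member 𝒢 {just true}  {just true}  a b h h′ ta tb = b , refl , tb
pick-member 𝒢 {just true}  {nothing}    a b h h′ ta tb = b , refl , tb
pick-member 𝒢 {nothing}    {just true}  a b h h′ ta tb = a , refl , ta
pick-member 𝒢 {nothing}    {nothing}    a b h h′ ta tb with ∣ b ∣ ≤ᵇ ∣ a ∣
... | true  = a , refl , ta
... | false = b , refl , tb

mapMaybe-any : ∀ {P : B → Set} (f : A → Maybe B) {x y xs} →
               x ∈ xs → f x ≡ just y → P y → Any P (mapMaybe f xs)
mapMaybe-any f (here refl)              eq py rewrite eq = here py
mapMaybe-any f {xs = z ∷ _} (there x∈) eq py with f z
... | just _  = there (mapMaybe-any f x∈ eq py)
... | nothing = mapMaybe-any f x∈ eq py

-- The split of `s` into two members has no part that is decided to be out, so `pick` cannot discard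
-- it, and either choice of part yields a member. The two cases are the two orientations in
-- `halves`.
clause-any : ∀ {𝒢 : Family n} {σ} → Splits 𝒢 → 𝒢 ⊨ σ → ∀ s → Any (T ∘ 𝒢) (clause σ s)
clause-any {𝒢 = 𝒢} split h s with split s
... | a , b , ta , tb , disj , refl with ∈-halves a b disj
...   | inj₁ i with pick-member 𝒢 a b (h a) (h b) ta tb
...     | c , eq , tc = mapMaybe-any _ i eq tc
clause-any {𝒢 = 𝒢} split h s | a , b , ta , tb , disj , refl | inj₂ i
  with pick-member 𝒢 b a (h b) (h a) tb ta
...     | c , eq , tc = mapMaybe-any _ i eq tc

-- Lower bounds by weighted clause counting

-- If the weights of all sets are at most w · large i, then w · ∣ 𝒢 ^≥ i ∣ is at least the
-- total weight of 𝒢, to which each member forced by σ contributes w, and each clause, which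
-- raises the weight of its entries by one, at least 1.  With w = 0 this refutes an
-- assignment for which the clause of some set is empty.

forcedWeight : ℕ → Maybe Bool → ℕ → ℕ
forcedWeight w (just true)  v = w * v
forcedWeight w (just false) v = 0
forcedWeight w nothing      v = 0

forced : ℕ → ℕ → Assignment n → Trie ℕ n
forced w i σ = zipTrie (forcedWeight w) σ (large i)

weights : ℕ → ℕ → Assignment n → List (Subset n) → Trie ℕ n
weights w i σ []       = forced w i σ
weights w i σ (s ∷ ss) = foldr (λ c → update c suc) (weights w i σ ss) (clause σ s)

-- The forced weight is nonzero only on sets decided to be members, so `𝒢` collects all of it. The
-- general `u` stands in for `large i` because the threshold changes on passing to subtries.
weigh-forced : ∀ w {𝒢 : Family n} σ u → 𝒢 ⊨ σ →
               weigh (zipTrie (forcedWeight w) σ u) 𝒢 ≡ mass (zipTrie (forcedWeight w) σ u)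
weigh-forced w {𝒢} (leaf m) (leaf v) h with m | 𝒢 [] | h []
... | just true  | true  | refl = refl
... | just false | _     | refl = refl
... | nothing    | true  | _    = refl
... | nothing    | false | _    = refl
weigh-forced w (node l r) (node l′ r′) h =
  cong₂ _+_ (weigh-forced w l l′ (h ∘ _)) (weigh-forced w r r′ (h ∘ _))

-- A single member among the entries makes the growth strict; raising the weight of the other
-- entries never lowers the total.
weigh-clause : ∀ (𝒢 : Family n) t {cs} → Any (T ∘ 𝒢) cs →
               weigh t 𝒢 < weigh (foldr (λ c → update c suc) t cs) 𝒢
weigh-clause 𝒢 t {c ∷ cs} (here tc) rewrite weigh-update c (foldr (λ c → update c suc) t cs) 𝒢
                                          | to T-≡ tc = s≤s (grow cs)
  where
  grow : ∀ cs → weigh t 𝒢 ≤ weigh (foldr (λ c → update c suc) t cs) 𝒢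
  grow []       = ≤-refl
  grow (c ∷ cs) rewrite weigh-update c (foldr (λ c → update c suc) t cs) 𝒢 =
    ≤-trans (grow cs) (m≤n+m _ _)
weigh-clause 𝒢 t {c ∷ cs} (there any) rewrite weigh-update c (foldr (λ c → update c suc) t cs) 𝒢 =
  ≤-trans (weigh-clause 𝒢 t any) (m≤n+m _ _)

weigh-weights : ∀ w i {𝒢 : Family n} {σ} → Splits 𝒢 → 𝒢 ⊨ σ → ∀ ss →
                length ss + mass (forced w i σ) ≤ weigh (weights w i σ ss) 𝒢
weigh-weights w i {σ = σ} split h []       = ≤-reflexive (sym (weigh-forced w σ (large i) h))
weigh-weights w i {σ = σ} split h (s ∷ ss) =
  ≤-trans (s≤s (weigh-weights w i split h ss))
          (weigh-clause _ (weights w i σ ss) (clause-any {σ = σ} split h s))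

-- A fractional packing of clauses, scaled by `w` to integers: a feasible solution of the linear
-- program dual to minimising the size of `𝒢 ^≥ i`. Repetitions in `ss` are the multiplicities, and
-- the `suc` makes the bound exceed `B`.
bounded : ℕ → ℕ → Assignment n → ℕ → List (Subset n) → Bool
bounded i B σ w ss = (suc (w * B) ≤ᵇ length ss + mass (forced w i σ)) ∧
                     all₂ _≤ᵇ_ (weights w i σ ss) (mapTrie (w *_) (large i))

bounded-sound : ∀ i B {𝒢 : Family n} σ w ss → Splits 𝒢 → 𝒢 ⊨ σ → card (𝒢 ^≥ i) ≤ B →
                ¬ T (bounded i B σ w ss)
bounded-sound i B {𝒢} σ w ss split h c≤B t with to T-∧ t
... | many , light = <-irrefl refl (begin-strict
  w * B                            <⟨ ≤ᵇ⇒≤ _ _ many ⟩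
  length ss + mass (forced w i σ)  ≤⟨ weigh-weights w i split h ss ⟩
  weigh (weights w i σ ss) 𝒢       ≤⟨ weigh-mono (weights w i σ ss) limit light 𝒢 ⟩
  weigh limit 𝒢                    ≡⟨ weigh-* w (large i) 𝒢 ⟩
  w * weigh (large i) 𝒢            ≡⟨ cong (w *_) (sym (card-^≥ i 𝒢)) ⟩
  w * card (𝒢 ^≥ i)                ≤⟨ *-monoʳ-≤ w c≤B ⟩
  w * B                            ∎)
  where
  open ≤-Reasoning
  limit = mapTrie (w *_) (large i)

-- Certificates and their checker

-- A subset is coded by its characteristic vector read in base 2, a list of codes by its
-- digits in base 128, and a list of transpositions by their successors as digits in base 8;
-- first entries are the lowest digits.  No digit is 0, so the end of the list is recognised.

decode : ∀ n → ℕ → Subset n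
decode zero    c = []
decode (suc n) c = (c % 2 ≡ᵇ 1) ∷ decode n (c / 2)

digits : (b : ℕ) .{{_ : NonZero b}} → ℕ → ℕ → List ℕ
digits b zero       c = []
digits b (suc fuel) 0 = []
digits b (suc fuel) c = c % b ∷ digits b fuel (c / b)

-- known k π appeals to the assignment settled k + 1 lemmas earlier, renamed by π.

data Proof : Set where
  branch : ℕ → Proof → Proof → Proof
  bound  : ℕ → ℕ → Proof
  known  : ℕ → ℕ → Proof

nth : List A → ℕ → Maybe A
nth []       _       = nothing
nth (x ∷ xs) zero    = just x
nth (x ∷ xs) (suc k) = nth xs k

nth-All : ∀ {P : A → Set} {xs x} k → All P xs → nth xs k ≡ just x → P x
nth-All zero    (px ∷ _)   refl = px
nth-All (suc k) (_  ∷ pxs) eq   = nth-All k pxs eq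

-- Soundness puts no condition on the coding: whatever lists and renamings result from decoding,
-- passing the check is enough. The fuel only limits the length of a list.
decodes : ∀ n → ℕ → List (Subset n)
decodes n c = map (decode n) (digits 128 60 c)

permutation : ℕ → List ℕ
permutation c = map pred (digits 8 30 c)

infix 6 given_excluding_by_

record Lemma : Set where
  constructor given_excluding_by_
  field
    ins outs : ℕ
    proof    : Proof

module _ (i B : ℕ) where

  check : List (Assignment n) → Assignment n → Proof → Bool
  check {n} Γ σ (branch c p q) =
    check Γ (assign true (decode n c) σ) p ∧ check Γ (assign false (decode n c) σ) q
  check {n} Γ σ (bound w ss)   = bounded i B σ w (decodes n ss)
  -- An index beyond the end of `Γ` makes the check fail.
  check     Γ σ (known k π)    = maybe′ (_⊑ swapsTrie (permutation π) σ) false (nth Γ k)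

  assumptions : Assignment n → Lemma → Assignment n
  assumptions {n} σ (given ins excluding outs by _) =
    foldr (assign true) (foldr (assign false) σ (decodes n outs)) (decodes n ins)

  verify : Assignment n → List (Assignment n) → List Lemma → Proof → Bool
  verify σ Γ []       p = check Γ σ p
  verify σ Γ (l ∷ ls) p =
    check Γ (assumptions σ l) (Lemma.proof l) ∧ verify σ (assumptions σ l ∷ Γ) ls p

  -- The goal only has to be invariant under renaming. With an empty goal the checker refutes that a
  -- family is small; with `ContainsConstr` it identifies the extremal families.
  module Soundness
    (Goal : Family n → Set) (Goal-swap : ∀ k 𝒢 → Goal (𝒢 ∘ swap k) → Goal 𝒢) where

    Small : Family n → Set
    Small 𝒢 = Splits 𝒢 × card (𝒢 ^≥ i) ≤ B

    Settled : Assignment n → Set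
    Settled σ = ∀ 𝒢 → Small 𝒢 → 𝒢 ⊨ σ → Goal 𝒢

    Small-swaps : ∀ π {𝒢} → Small 𝒢 → Small (𝒢 ∘ swaps π)
    Small-swaps []          small         = small
    Small-swaps (k ∷ π) {𝒢} (split , c≤B) = Small-swaps π (Splits-swap k split , (begin
      card ((𝒢 ∘ swap k) ^≥ i)      ≡⟨ card-^≥ i (𝒢 ∘ swap k) ⟩
      weigh (large i) (𝒢 ∘ swap k)  ≡⟨ weigh-swap k i 𝒢 ⟩
      weigh (large i) 𝒢             ≡⟨ sym (card-^≥ i 𝒢) ⟩
      card (𝒢 ^≥ i)                 ≤⟨ c≤B ⟩
      B                             ∎))
      where open ≤-Reasoning

    Goal-swaps : ∀ π {𝒢} → Goal (𝒢 ∘ swaps π) → Goal 𝒢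
    Goal-swaps []          goal = goal
    Goal-swaps (k ∷ π) {𝒢} goal = Goal-swap k 𝒢 (Goal-swaps π goal)

    check-sound : ∀ {Γ} → All Settled Γ → ∀ σ p → T (check Γ σ p) → Settled σ
    check-sound Γ-settled σ (branch c p q) ok 𝒢 small 𝒢⊨σ
      with to T-∧ ok | 𝒢 (decode n c) in eq
    ... | ok₁ , _ | true  =
      check-sound Γ-settled _ p ok₁ 𝒢 small (⊨-assign (decode n c) true eq 𝒢⊨σ)
    ... | _ , ok₂ | false =
      check-sound Γ-settled _ q ok₂ 𝒢 small (⊨-assign (decode n c) false eq 𝒢⊨σ)
    check-sound Γ-settled σ (bound w ss) ok 𝒢 (split , c≤B) 𝒢⊨σ =
      ⊥-elim (bounded-sound i B σ w (decodes n ss) split 𝒢⊨σ c≤B ok)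
    check-sound {Γ} Γ-settled σ (known k c) ok 𝒢 small 𝒢⊨σ with nth Γ k in eq
    -- Renaming by `π` turns `𝒢` into an equally small family that matches `τ`; invariance of `Goal`
    -- brings the conclusion back to `𝒢`.
    ... | just τ = Goal-swaps π (nth-All k Γ-settled eq (𝒢 ∘ swaps π) (Small-swaps π small)
                                  (⊑-⊨ τ _ ok (⊨-swaps π 𝒢⊨σ)))
      where π = permutation c

    -- `Γ` may start with assignments settled by other means, which is how the extremal families
    -- enter.
    verify-sound : ∀ σ {Γ} → All Settled Γ → ∀ ls p → verify σ Γ ls p ≡ true → Settled σ
    verify-sound σ Γ-settled ls p ok = go Γ-settled ls (from T-≡ ok)
      where
      go : ∀ {Γ} → All Settled Γ → ∀ ls → T (verify σ Γ ls p) → Settled σ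
      go Γ-settled []       ok = check-sound Γ-settled σ p ok
      go Γ-settled (l ∷ ls) ok with to T-∧ ok
      ... | ok₁ , ok₂ =
        go (check-sound Γ-settled (assumptions σ l) (Lemma.proof l) ok₁ ∷ Γ-settled) ls ok₂

-- Required members and inclusion of families

tabulate : (Subset n → A) → Trie A n
tabulate {zero}  f = leaf (f [])
tabulate {suc n} f = node (tabulate (f ∘ (inside ∷_))) (tabulate (f ∘ (outside ∷_)))

lookup-tabulate : ∀ (f : Subset n → A) s → lookup (tabulate f) s ≡ f s
lookup-tabulate f []            = refl
lookup-tabulate f (inside  ∷ s) = lookup-tabulate (f ∘ (inside ∷_)) s
lookup-tabulate f (outside ∷ s) = lookup-tabulate (f ∘ (outside ∷_)) s

infix 4 _⊆ᶠ_

_⊆ᶠ_ : Family n → Family n → Set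
ℱ ⊆ᶠ 𝒢 = ∀ s → s ∈ᶠ ℱ → s ∈ᶠ 𝒢

require : Family n → Assignment n
require ℱ = tabulate (λ s → if ℱ s then just true else nothing)

⊨-require⁺ : ∀ {ℱ 𝒢 : Family n} → ℱ ⊆ᶠ 𝒢 → 𝒢 ⊨ require ℱ
⊨-require⁺ {ℱ = ℱ} h s rewrite lookup-tabulate (λ s → if ℱ s then just true else nothing) s
  with ℱ s | h s
... | true  | hs = to T-≡ (hs tt)
... | false | _  = tt

⊨-require⁻ : ∀ {ℱ 𝒢 : Family n} → 𝒢 ⊨ require ℱ → ℱ ⊆ᶠ 𝒢
⊨-require⁻ {ℱ = ℱ} h s ts with h s
... | hs rewrite lookup-tabulate (λ s → if ℱ s then just true else nothing) s | to T-≡ ts =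
  from T-≡ hs

card-mono : ∀ {ℱ 𝒢 : Family n} → ℱ ⊆ᶠ 𝒢 → card ℱ ≤ card 𝒢
card-mono {zero} {ℱ} {𝒢} h with ℱ [] | 𝒢 [] | h []
... | true  | true  | _ = ≤-refl
... | true  | false | f = ⊥-elim (f tt)
... | false | _     | _ = z≤n
card-mono {suc n} {ℱ} {𝒢} h rewrite card-∷ ℱ | card-∷ 𝒢 =
  +-mono-≤ (card-mono (h ∘ (inside ∷_))) (card-mono (h ∘ (outside ∷_)))

-- Inclusion bounds the size of `ℱ` by that of `𝒢` on each half, so the total leaves no slack on
-- either half and the induction applies to both.
⊆ᶠ∧card≥⇒≗ : ∀ {ℱ 𝒢 : Family n} → ℱ ⊆ᶠ 𝒢 → card 𝒢 ≤ card ℱ → 𝒢 ≗ ℱ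
⊆ᶠ∧card≥⇒≗ {zero} {ℱ} {𝒢} h c [] with ℱ [] | 𝒢 [] | h []
... | true  | true  | _ = refl
... | true  | false | f = ⊥-elim (f tt)
... | false | false | _ = refl
⊆ᶠ∧card≥⇒≗ {suc n} {ℱ} {𝒢} h c s rewrite card-∷ ℱ | card-∷ 𝒢 = go s
  where
  ℱᵢ = ℱ ∘ (inside ∷_) ; ℱₒ = ℱ ∘ (outside ∷_)
  𝒢ᵢ = 𝒢 ∘ (inside ∷_) ; 𝒢ₒ = 𝒢 ∘ (outside ∷_)
  go : 𝒢 ≗ ℱ
  go (inside  ∷ s) = ⊆ᶠ∧card≥⇒≗ (h ∘ (inside ∷_)) (+-cancelʳ-≤ (card ℱₒ) (card 𝒢ᵢ) (card ℱᵢ)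
    (≤-trans (+-monoʳ-≤ (card 𝒢ᵢ) (card-mono (h ∘ (outside ∷_)))) c)) s
  go (outside ∷ s) = ⊆ᶠ∧card≥⇒≗ (h ∘ (outside ∷_)) (+-cancelˡ-≤ (card ℱᵢ) (card 𝒢ₒ) (card ℱₒ)
    (≤-trans (+-monoˡ-≤ (card 𝒢ₒ) (card-mono (h ∘ (inside ∷_)))) c)) s

^≥-mono : ∀ i {ℱ 𝒢 : Family n} → ℱ ⊆ᶠ 𝒢 → ℱ ^≥ i ⊆ᶠ 𝒢 ^≥ i
^≥-mono i h s t with to T-∧ t
... | sℱ , large = from T-∧ (h s sℱ , large)

^≥-⊆ᶠ : ∀ i (𝒢 : Family n) → 𝒢 ^≥ i ⊆ᶠ 𝒢
^≥-⊆ᶠ i 𝒢 s t = proj₁ (to T-∧ t)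

-- From generators to splits

withEmpty : Family n → Family n
withEmpty 𝒢 s = 𝒢 s ∨ (∣ s ∣ ≡ᵇ 0)

card-withEmpty : ∀ i (𝒢 : Family n) → card (withEmpty 𝒢 ^≥ suc i) ≡ card (𝒢 ^≥ suc i)
card-withEmpty i 𝒢 = card-cong same
  where
  same : ∀ s → (withEmpty 𝒢 ^≥ suc i) s ≡ (𝒢 ^≥ suc i) s
  same s with ∣ s ∣
  ... | zero  = trans (∧-zeroʳ (𝒢 s ∨ true)) (sym (∧-zeroʳ (𝒢 s)))
  ... | suc m = cong (_∧ (i <ᵇ suc m)) (∨-identityʳ (𝒢 s))

⊆ᶠ-withEmpty : (𝒢 : Family n) → 𝒢 ⊆ᶠ withEmpty 𝒢
⊆ᶠ-withEmpty 𝒢 s t = from T-∨ (inj₁ t)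

⊥∈withEmpty : ∀ {n} (𝒢 : Family n) → ⊥ ∈ᶠ withEmpty 𝒢
⊥∈withEmpty {n} 𝒢 rewrite ∣⊥∣≡0 n | ∨-zeroʳ (𝒢 ⊥) = tt

∣p∣≡0⇒p≡⊥ : ∀ (p : Subset n) → ∣ p ∣ ≡ 0 → p ≡ ⊥
∣p∣≡0⇒p≡⊥ []            _  = refl
∣p∣≡0⇒p≡⊥ (outside ∷ p) eq = cong (outside ∷_) (∣p∣≡0⇒p≡⊥ p eq)

withEmpty-nonempty : ∀ {𝒢 : Family n} s → Nonempty s → s ∈ᶠ withEmpty 𝒢 → s ∈ᶠ 𝒢
withEmpty-nonempty {𝒢 = 𝒢} s (x , x∈s) s∈ with to (T-∨ {𝒢 s}) s∈
... | inj₁ s∈𝒢   = s∈𝒢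
... | inj₂ ∣s∣≡0 =
  contradiction (subst (x Subset.∈_) (∣p∣≡0⇒p≡⊥ s (≡ᵇ⇒≡ ∣ s ∣ 0 ∣s∣≡0)) x∈s) ∉⊥

-- Lists with fewer than two members are padded with `⊥`. As `⋃` folds from `⊥`, the union of `a`
-- and `b` appears as `a ∪ (b ∪ ⊥)`.
generator⇒Splits : ∀ {𝒢 : Family n} → IsGenerator n 2 𝒢 → Splits (withEmpty 𝒢)
generator⇒Splits {𝒢 = 𝒢} gen s with nonempty? s
... | no s-empty = ⊥ , ⊥ , ⊥∈withEmpty 𝒢 , ⊥∈withEmpty 𝒢 , ∩-idem ⊥ ,
  trans (∪-idem ⊥) (sym (Empty-unique s-empty))
... | yes s-nonempty with gen s s-nonempty
...   | [] , _ , _ , _ , refl =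
  ⊥ , ⊥ , ⊥∈withEmpty 𝒢 , ⊥∈withEmpty 𝒢 , ∩-idem ⊥ , ∪-idem ⊥
...   | a ∷ [] , _ , a∈ ∷ [] , _ , eq =
  a , ⊥ , ⊆ᶠ-withEmpty 𝒢 a a∈ , ⊥∈withEmpty 𝒢 , ∩-zeroʳ a , eq
...   | a ∷ b ∷ [] , _ , a∈ ∷ b∈ ∷ [] , (disj ∷ []) ∷ _ , eq =
  a , b , ⊆ᶠ-withEmpty 𝒢 a a∈ , ⊆ᶠ-withEmpty 𝒢 b b∈ , Empty-unique disj ,
  trans (cong (a ∪_) (sym (∪-identityʳ b))) eq
...   | _ ∷ _ ∷ _ ∷ _ , s≤s (s≤s ()) , _

atMost1 : Family n
atMost1 s = ∣ s ∣ ≤ᵇ 1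

-- One part of any split of a set of size at most one is the set itself. This justifies the
-- assignment from which every case distinction starts.
atMost1⊆Splits : ∀ {𝒢 : Family n} → Splits 𝒢 → atMost1 ⊆ᶠ 𝒢
atMost1⊆Splits {𝒢 = 𝒢} split s h with split s
... | a , b , a∈ , b∈ , disj , refl =
  [ (λ e → subst (T ∘ 𝒢) (sym e) a∈) , (λ e → subst (T ∘ 𝒢) (sym e) b∈) ]′
    (whole a b disj (≤ᵇ⇒≤ _ _ h))
  where
  empties : ∀ {n} (a b : Subset n) → ∣ a ∪ b ∣ ≤ 0 → a ∪ b ≡ a × a ∪ b ≡ b
  empties []            []            _ = refl , refl
  empties (outside ∷ a) (outside ∷ b) h =
    Product.map (cong (outside ∷_)) (cong (outside ∷_)) (empties a b h)
  empties (inside  ∷ a) (inside  ∷ b) ()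
  empties (inside  ∷ a) (outside ∷ b) ()
  empties (outside ∷ a) (inside  ∷ b) ()

  whole : ∀ {n} (a b : Subset n) → a ∩ b ≡ ⊥ → ∣ a ∪ b ∣ ≤ 1 → a ∪ b ≡ a ⊎ a ∪ b ≡ b
  whole []            []            _ _       = inj₁ refl
  whole (inside  ∷ a) (outside ∷ b) _ (s≤s h) = inj₁ (cong (inside ∷_) (proj₁ (empties a b h)))
  whole (outside ∷ a) (inside  ∷ b) _ (s≤s h) = inj₂ (cong (inside ∷_) (proj₂ (empties a b h)))
  whole (outside ∷ a) (outside ∷ b) d h       =
    Sum.map (cong (outside ∷_)) (cong (outside ∷_)) (whole a b (∷-injectiveʳ d) h)

-- The families `Constr V₁ V₂` under renaming

does⁺ : ∀ {P : Set} (P? : Dec P) → P → T (does P?)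
does⁺ (yes _) _ = tt
does⁺ (no ¬p) p = ¬p p

does⁻ : ∀ {P : Set} (P? : Dec P) → T (does P?) → P
does⁻ (yes p) _ = p

-- Inclusion is recast as the equation `p ∩ q ≡ p`, which `swap` respects.
⊆-swap : ∀ k {p q : Subset n} → p ⊆ q → swap k p ⊆ swap k q
⊆-swap k {p} {q} p⊆q = subst (_⊆ swap k q) p∩q≡p (p∩q⊆q (swap k p) (swap k q))
  where
  p∩q≡p : swap k p ∩ swap k q ≡ swap k p
  p∩q≡p = trans (sym (swap-zipWith _ k p q))
    (cong (swap k) (⊆-antisym (p∩q⊆p p q) (λ x∈p → x∈p∩q⁺ (x∈p , p⊆q x∈p))))

Empty-swap : ∀ k {p : Subset n} → Empty p → Empty (swap k p)
Empty-swap {n} k empty (x , x∈) =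
  ∉⊥ (subst (x Subset.∈_)
        (trans (cong (swap k) (Empty-unique empty)) (swap-replicate k n _)) x∈)

Nonempty-swap : ∀ k {p : Subset n} → Nonempty p → Nonempty (swap k p)
Nonempty-swap k {p} p≢∅ with nonempty? (swap k p)
... | yes ne    = ne
... | no  empty = contradiction p≢∅ (subst Empty (swap-involutive k p) (Empty-swap k empty))

Constr-swap : ∀ k (V₁ V₂ g : Subset n) →
              g ∈ᶠ Constr V₁ V₂ → swap k g ∈ᶠ Constr (swap k V₁) (swap k V₂)
Constr-swap k V₁ V₂ g g∈ with to T-∧ g∈
... | part , ne = from T-∧
  ( from T-∨ (Sum.map (λ h → does⁺ (swap k g ⊆? _) (⊆-swap k (does⁻ (g ⊆? V₁) h)))
                      (λ h → does⁺ (swap k g ⊆? _) (⊆-swap k (does⁻ (g ⊆? V₂) h)))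
                      (to (T-∨ {𝒫 V₁ g}) part))
  , does⁺ (nonempty? _) (Nonempty-swap k (does⁻ (nonempty? g) ne)))

Constr-nonempty : ∀ (V₁ V₂ g : Subset n) → g ∈ᶠ Constr V₁ V₂ → Nonempty g
Constr-nonempty V₁ V₂ g g∈ = does⁻ (nonempty? g) (proj₂ (to (T-∧ {𝒫 V₁ g ∨ 𝒫 V₂ g}) g∈))

IsPartition-swap : ∀ k {V₁ V₂} → IsPartition₃₄ V₁ V₂ → IsPartition₃₄ (swap k V₁) (swap k V₂)
IsPartition-swap k {V₁} {V₂} (disj , cover , c₁ , c₂) =
  subst Empty (swap-zipWith _ k V₁ V₂) (Empty-swap k disj) ,
  trans (sym (swap-zipWith _ k V₁ V₂)) (trans (cong (swap k) cover) (swap-replicate k 7 _)) ,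
  trans (∣swap∣ k V₁) c₁ ,
  trans (∣swap∣ k V₂) c₂

-- The partition is quantified rather than fixed, which makes the property invariant under renaming,
-- as a goal of the checker must be.
ContainsConstr : Family 7 → Set
ContainsConstr 𝒢 = ∃[ V₁ ] ∃[ V₂ ] IsPartition₃₄ V₁ V₂ × Constr V₁ V₂ ⊆ᶠ 𝒢

ContainsConstr-swap : ∀ k 𝒢 → ContainsConstr (𝒢 ∘ swap k) → ContainsConstr 𝒢
ContainsConstr-swap k 𝒢 (V₁ , V₂ , part , incl) =
  swap k V₁ , swap k V₂ , IsPartition-swap k part , λ g g∈ →
  subst (T ∘ 𝒢) (swap-involutive k g) (incl (swap k g)
    (subst₂ (λ U₁ U₂ → swap k g ∈ᶠ Constr U₁ U₂) (swap-involutive k V₁) (swap-involutive k V₂)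
      (Constr-swap k (swap k V₁) (swap k V₂) g g∈)))

-- Sizes of the levels of `Constr V₁ V₂`

constrSize : ℕ → ℕ
-- The empty set is not a member, so levels 0 and 1 agree. The 15 sets at level 2 are 3 + 6 pairs, 1
-- + 4 triples and one quadruple; the seven singletons complete the 22.
constrSize 0 = 22
constrSize 1 = 22
constrSize 2 = 15
constrSize 3 = 6
constrSize _ = 1

HasConstrSize : Subset 7 × Subset 7 → ℕ → Bool
HasConstrSize (V₁ , V₂) i = card (Constr V₁ V₂ ^≥ i) ≡ᵇ constrSize i

HasConstrSizes : Subset 7 × Subset 7 → Bool
HasConstrSizes (V₁ , V₂) = not (∣ V₁ ∣ ≡ᵇ 3) ∨ all (HasConstrSize (V₁ , V₂)) (upTo 5)

-- Evaluates the sizes over all 128 ordered splits of `⊤`, among which every partition occurs; the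
-- guard passes over first parts of size other than three.
splits-HasConstrSizes : all HasConstrSizes (splits ⊤) ≡ true
splits-HasConstrSizes = refl

all-∈ : ∀ (p : A → Bool) xs → all p xs ≡ true → ∀ {x} → x ∈ xs → p x ≡ true
all-∈ p (x ∷ xs) h (here refl) with p x
... | true = refl
all-∈ p (x ∷ xs) h (there x∈) with p x
... | true = all-∈ p xs h x∈

card-Constr : ∀ V₁ V₂ → IsPartition₃₄ V₁ V₂ → ∀ i → i < 5 →
              card (Constr V₁ V₂ ^≥ i) ≡ constrSize i
card-Constr V₁ V₂ (disj , cover , c₁ , _) i i<5 =
  ≡ᵇ⇒≡ (card (Constr V₁ V₂ ^≥ i)) (constrSize i)
    (from (T-≡ {HasConstrSize (V₁ , V₂) i})
      (all-∈ (HasConstrSize (V₁ , V₂)) (upTo 5) sizes (∈-upTo⁺ i<5)))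
  where
  V∈ : (V₁ , V₂) ∈ splits ⊤
  V∈ = subst (λ s → (V₁ , V₂) ∈ splits s) cover (∈-splits V₁ V₂ (Empty-unique disj))

  drop-guard : ∀ {m b} → m ≡ 3 → not (m ≡ᵇ 3) ∨ b ≡ true → b ≡ true
  drop-guard refl h = h

  sizes : all (HasConstrSize (V₁ , V₂)) (upTo 5) ≡ true
  sizes = drop-guard {∣ V₁ ∣} {all (HasConstrSize (V₁ , V₂)) (upTo 5)} c₁
            (all-∈ HasConstrSizes (splits ⊤) splits-HasConstrSizes V∈)

-- A set is the union of its traces on `V₁` and `V₂`. An empty trace has to be left out, since `∅`
-- is not in `Constr V₁ V₂`.
Constr-generator : ∀ {V₁ V₂ : Subset n} → Disjoint V₁ V₂ → V₁ ∪ V₂ ≡ ⊤ →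
                   IsGenerator n 2 (Constr V₁ V₂)
Constr-generator {n} {V₁} {V₂} disj cover s _ = union (nonempty? (s ∩ V₁)) (nonempty? (s ∩ V₂))
  where
  whole : s ∩ V₁ ∪ s ∩ V₂ ≡ s
  whole = trans (sym (∩-distribˡ-∪ s V₁ V₂)) (trans (cong (s ∩_) cover) (∩-identityʳ s))

  in₁ : Nonempty (s ∩ V₁) → s ∩ V₁ ∈ᶠ Constr V₁ V₂
  in₁ ne = from T-∧ (from T-∨ (inj₁ (does⁺ (s ∩ V₁ ⊆? V₁) (p∩q⊆q s V₁))) , does⁺ (nonempty? _) ne)

  in₂ : Nonempty (s ∩ V₂) → s ∩ V₂ ∈ᶠ Constr V₁ V₂
  in₂ ne = from T-∧ (from (T-∨ {𝒫 V₁ (s ∩ V₂)}) (inj₂ (does⁺ (s ∩ V₂ ⊆? V₂) (p∩q⊆q s V₂)))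
                    , does⁺ (nonempty? _) ne)

  apart : Disjoint (s ∩ V₁) (s ∩ V₂)
  apart (x , x∈) = disj (x , x∈p∩q⁺ ( p∩q⊆q s V₁ (p∩q⊆p (s ∩ V₁) _ x∈)
                                     , p∩q⊆q s V₂ (p∩q⊆q (s ∩ V₁) _ x∈)))

  union : Dec (Nonempty (s ∩ V₁)) → Dec (Nonempty (s ∩ V₂)) →
          DisjointUnionOf≤ 2 (Constr V₁ V₂) s
  union (yes ne₁) (yes ne₂) =
    s ∩ V₁ ∷ s ∩ V₂ ∷ [] , ≤-refl , in₁ ne₁ ∷ in₂ ne₂ ∷ [] , (apart ∷ []) ∷ [] ∷ [] ,
    trans (cong (s ∩ V₁ ∪_) (∪-identityʳ (s ∩ V₂))) whole
  union (yes ne₁) (no e₂) =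
    s ∩ V₁ ∷ [] , s≤s z≤n , in₁ ne₁ ∷ [] , [] ∷ [] ,
    trans (cong (s ∩ V₁ ∪_) (sym (Empty-unique e₂))) whole
  union (no e₁) (yes ne₂) =
    s ∩ V₂ ∷ [] , s≤s z≤n , in₂ ne₂ ∷ [] , [] ∷ [] ,
    trans (∪-comm (s ∩ V₂) ⊥) (trans (cong (_∪ s ∩ V₂) (sym (Empty-unique e₁))) whole)
  union (no e₁) (no e₂) =
    [] , z≤n , [] , [] ,
    trans (sym (∪-idem ⊥)) (trans (sym (cong₂ _∪_ (Empty-unique e₁) (Empty-unique e₂))) whole)

-- Certificates for the levels 3 and 2

lemmas₃ : List Lemma
lemmas₃ =
  given 16281 excluding 67 by branch 7 (bound 2 25727655804) (branch 97 (bound 2 33385475023)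
    (branch 70 (bound 2 16873518579) (branch 69 (bound 2 25633437171) (bound 4
    1847081327871426874752363495)))) ∷
  given 16281 excluding 0 by branch 67 (bound 3 490345106157430) (known 0 0) ∷
  given 8639 excluding 0 by branch 25 (bound 3 422019040377694) (branch 56 (bound 4
    3449153628973780957) (branch 26 (bound 2 31907609789) (branch 50 (bound 3 558409832168607)
    (branch 28 (bound 2 29507845435) (branch 58 (bound 2 29776375545) (branch 52 (bound 2
    29458599867) (branch 22 (bound 2 25759260347) (bound 4 2398335793200966028516384446))))))))
    ∷
  given 63 excluding 0 by branch 67 (known 0 0) (branch 97 (known 0 1253) (branch 73 (known 0
    19) (branch 81 (known 0 156) (branch 69 (known 0 2) (branch 37 (bound 2 275906987617259)
    (branch 49 (bound 2 275897885849319) (branch 113 (bound 2 276379987310311) (branch 112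
    (bound 2 275830814406119) (branch 100 (bound 2 275895771593209) (branch 21 (bound 2
    275827044089075) (branch 85 (bound 2 275827044088313) (branch 41 (bound 2 275417927383541)
    (branch 105 (bound 4 2318562670449858254097480181) (branch 52 (bound 4
    2320795495481492082146473721) (branch 84 (bound 3 1157440654896539694841) (bound 2
    8465991863487065845)))))))))))))))) ∷
  given 6303 excluding 12489 by branch 11 (bound 2 33215722477) (branch 98 (bound 3
    276921971338703) (branch 41 (bound 2 16891996123) (branch 13 (bound 2 33802923499) (branch
    104 (bound 2 31871920047) (branch 42 (bound 3 544180658728423) (branch 44 (bound 2
    25213973483) (bound 3 1032796141527051974379))))))) ∷
  given 6303 excluding 97 by branch 73 (bound 3 545185143953383) (known 0 0) ∷
  given 31 excluding 0 by branch 97 (branch 38 (bound 3 552906071653949) (branch 22 (bound 4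
    5745175715649591278) (branch 50 (bound 3 411138929437615) (branch 42 (bound 3
    492425983679478) (bound 4 2432013985144147051500379959))))) (branch 49 (known 0 0) (branch
    37 (known 0 35) (branch 41 (known 0 4) (branch 35 (known 0 282) (branch 81 (bound 2
    415335109850043) (branch 67 (bound 2 415322224720633) (branch 99 (bound 2 415060655536889)
    (branch 98 (bound 2 415472972201205) (branch 112 (bound 2 415528370697709) (branch 113
    (bound 4 1817728209479656945694471655) (branch 82 (known 1 3281) (bound 2
    8339810538434984691)))))))))))) ∷
  given 12559 excluding 1846353 by branch 84 (bound 3 556313539997177) (branch 85 (bound 2
    14962588924) (branch 89 (bound 2 16036867061) (branch 92 (bound 2 16835280117) (bound 4
    2475794444090747304329738973)))) ∷
  given 12559 excluding 14424 by branch 81 (bound 3 560471076728700) (known 0 0) ∷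
  given 12559 excluding 112 by branch 88 (bound 3 557159930355189) (known 0 0) ∷
  given 15 excluding 115 by branch 112 (branch 69 (bound 3 551670963467758) (branch 21 (bound 3
    553563232591341) (branch 84 (bound 3 557297464997559) (branch 25 (bound 4
    9067920843055427415) (branch 88 (bound 2 28954189527) (branch 73 (bound 4
    9069398483491331799) (bound 4 2434548523678151832132513245))))))) (branch 98 (known 0 0)
    (branch 81 (known 1 2762) (branch 82 (known 0 5) (branch 97 (known 1 202) (branch 83 (bound
    4 2475499326152590649315998966) (branch 49 (known 1 191178) (branch 19 (bound 4
    2475537397863817878360145141) (branch 51 (bound 4 2465979331557511359312034523) (branch 84
    (known 2 346) (branch 113 (bound 3 1179347413236870655447) (branch 50 (known 2 2987) (branch
    114 (bound 3 1179326028673159462133) (branch 35 (bound 4 2434395849455542425328974709)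
    (branch 99 (bound 3 1179346058544056023925) (bound 4
    601815854783249520063061685903915891))))))))))))))) ∷
  []

-- Once `⊤` (code 127) is excluded, the sets of size six, five and four are tried in turn. The first
-- member found is renamed to 63, 31 or 15, where a lemma applies. If all are excluded, every split
-- of `⊤` is ruled out and its clause is empty: this is the final leaf, with weight 0.
proof₃ : Proof
proof₃ =
  branch 127 (branch 25 (known 9 0) (branch 11 (known 9 226) (branch 13 (known 9 28) (branch 41
  (known 9 5) (branch 73 (known 9 46) (branch 49 (bound 2 522173495564267) (branch 56 (bound 2
  522104776120299) (branch 27 (bound 2 521708972473533) (branch 57 (bound 2 522194303514015)
  (branch 50 (known 10 3425) (branch 26 (bound 2 521709097319613) (branch 19 (bound 2
  521709097311993) (bound 2 4318177358183398587))))))))))))) (branch 63 (known 7 0) (branch 95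
  (known 7 6) (branch 111 (known 7 53) (branch 119 (known 7 428) (branch 123 (known 7 3427)
  (branch 125 (known 7 27418) (branch 126 (known 7 219345) (branch 31 (known 4 0) (branch 47
  (known 4 5) (branch 55 (known 4 44) (branch 59 (known 4 355) (branch 61 (known 4 2842) (branch
  62 (known 4 22737) (branch 79 (known 4 46) (branch 87 (known 4 372) (branch 91 (known 4 2979)
  (branch 93 (known 4 23834) (branch 94 (known 4 190673) (branch 103 (known 4 2981) (branch 107
  (known 4 23851) (branch 109 (known 4 190810) (branch 110 (known 4 1526481) (branch 115 (known
  4 190812) (branch 117 (known 4 1526498) (branch 118 (known 4 12211985) (branch 121 (known 4
  12211987) (branch 122 (known 4 97695897) (branch 124 (known 4 781567178) (branch 15 (known 0
  0) (branch 23 (known 0 4) (branch 27 (known 0 35) (branch 29 (known 0 282) (branch 30 (known 0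
  2257) (branch 39 (known 0 37) (branch 43 (known 0 299) (branch 45 (known 0 2394) (branch 46
  (known 0 19153) (branch 51 (known 0 2396) (branch 53 (known 0 19170) (branch 54 (known 0
  153361) (branch 57 (known 0 153363) (branch 58 (known 0 1226905) (branch 60 (known 0 9815242)
  (branch 71 (known 0 302) (branch 75 (known 0 2419) (branch 77 (known 0 19354) (branch 78
  (known 0 154833) (branch 83 (known 0 19356) (branch 85 (known 0 154850) (branch 86 (known 0
  1238801) (branch 89 (known 0 1238803) (branch 90 (known 0 9910425) (branch 92 (known 0
  79283402) (branch 99 (known 0 154853) (branch 101 (known 0 1238826) (branch 102 (known 0
  9910609) (branch 105 (known 0 9910611) (branch 106 (known 0 79284889) (branch 108 (known 0
  634279114) (branch 113 (known 0 79284892) (branch 114 (known 0 634279137) (branch 116 (known 0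
  5074233098) (branch 120 (known 0 40593864787) (bound 0
  127))))))))))))))))))))))))))))))))))))))))))))))))))))))))))))))))

-- The list descends from nine required pairs to the single pair {0,1}. Exclusions are lifted
-- gradually: typically, branching on a freed set leads to an earlier lemma with more required sets,
-- up to renaming, or back to the preceding lemma.
lemmas₂ : List Lemma
lemmas₂ =
  given 6962856953985237635 excluding 0 by branch 68 (bound 2 150506611011480441234574) (branch
    34 (bound 3 4967759058456003834568307371034444) (branch 65 (bound 3
    5181491788510265614212672287770410) (branch 17 (bound 3 2503584400340092563367187974890700)
    (bound 3 3657946950948849237038145896550958786090)))) ∷
  given 54397319953007235 excluding 0 by branch 24 (known 0 0) (branch 12 (known 0 718042416337)
    (branch 65 (bound 3 6550372266872210767433782937946114166044) (branch 40 (bound 3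
    6550247641619872105374274958794563095836) (branch 34 (bound 2 2231629789729970853117365529)
    (branch 20 (bound 4 47773357806094804274457438297412966431575303512100010) (bound 1
    49449387682010396)))))) ∷
  given 54397530968490627 excluding 8353 by branch 34 (branch 20 (bound 3
    5189245640795927401733278463837993) (branch 6 (bound 3 5171578518416940921335046235131433)
    (bound 3 1956435986998727775521950675616899157526))) (branch 68 (bound 3
    10886791041161285936625548863816182682794) (branch 6 (bound 4
    34500196004167027439961685187805685342034015558241578) (branch 24 (bound 3
    10880965923205446839223585704820898294569) (branch 20 (bound 4
    9727520090362259452223764159423983957802612842466474) (bound 4
    2533593433897677336275514729237865536598518206464552476495382))))) ∷
  given 54397319953023619 excluding 152065057 by branch 9 (bound 3
    10862277191240072058732570715371486940492) (bound 2 7075020639087909161549249582281) ∷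
  given 424979062129283 excluding 33 by branch 65 (known 2 50) (branch 72 (known 1 0) (branch 40
    (known 1 50) (branch 34 (known 0 0) (branch 68 (known 0 50) (branch 9 (branch 18 (bound 2
    1768638175592932945586005546) (branch 20 (bound 2 1196637915884385711373592106) (bound 4
    2243416151391904929621915850859035486166450919865593325325900))) (branch 10 (bound 2
    23237966053499056094262102009001) (bound 3
    27436258093094089320832615348288945747503329536267561))))))) ∷
  given 424979062129283 excluding 0 by branch 33 (known 3 0) (known 0 0) ∷
  given 54397319898088067 excluding 84478996 by branch 65 (bound 2 2472809629215026120623493916)
    (branch 12 (branch 34 (bound 3 4368263841083345987103707181578774) (bound 3
    3317543903660570989172204097401636227878)) (bound 3
    7889370198245932232554755670593921759060530716)) ∷
  given 54397319898088067 excluding 659988 by branch 24 (known 2 689267569670346) (known 0 0) ∷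
  given 54397319914881667 excluding 592393 by branch 6 (bound 2 2475076664738033474730609865)
    (branch 72 (bound 2 2366963065930075278028723750) (bound 2
    23431629666575349482027905393830)) ∷
  given 424979061703299 excluding 9735309577 by branch 6 (branch 24 (bound 3
    6295196481397320080448932320658424747593) (bound 3
    13059872198705424420819666491199532776848772633)) (bound 4
    601159254628762552422965321315038533475179664185058247408070106172198) ∷
  given 424979061703299 excluding 592393 by branch 18 (known 1 0) (branch 34 (known 1 5) (known
    0 0)) ∷
  given 424979061703299 excluding 4628 by branch 9 (branch 40 (known 5 1973865981706) (known 3
    0)) (known 0 0) ∷
  given 424979062096515 excluding 75826441 by branch 68 (known 6 2) (branch 18 (bound 3
    20873439625576738582041884765792364562399782057) (branch 65 (bound 3
    20732723008125351544185366463669577690405833878) (branch 72 (bound 4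
    2711486406238147698592934131488623591840604174376293632773658) (bound 4
    1983601778711034656807648602913751835098637773085775611257065434417993)))) ∷
  given 3320148918915 excluding 592394 by branch 9 (branch 40 (known 7 3) (branch 24 (known 7
    43) (branch 6 (known 6 3) (branch 12 (branch 65 (known 2 202) (branch 72 (bound 2
    1775888280986067697792357670) (bound 2 39197659237440164523820873847574))) (bound 1
    6615724504570857244))))) (branch 34 (known 0 0) (branch 18 (known 0 5) (branch 12 (branch 68
    (known 3 2) (branch 65 (bound 2 38633279313850426455488903615274) (bound 2
    605301804166215901348216888130643098))) (branch 6 (branch 40 (known 5 689267569967770)
    (bound 2 214682561173365241808679334385964586)) (bound 2
    1881059785207026150409346695586268940070))))) ∷
  given 3320148918915 excluding 4628 by branch 10 (known 2 0) (known 0 0) ∷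
  given 3320148918915 excluding 36 by branch 20 (known 9 5) (known 0 0) ∷
  given 3320110531203 excluding 301344640862738 by branch 40 (known 1 403) (branch 72 (known 1
    19) (branch 6 (branch 65 (known 4 10) (branch 33 (bound 4
    4452815857115045590120117280604104118520563723989271003473194) (branch 12 (branch 10 (branch
    17 (bound 2 150632534873877648324903) (branch 19 (bound 2 150657682834696406115789) (branch
    25 (bound 2 150657697431915599898007) (branch 112 (branch 7 (branch 14 (branch 13 (branch 11
    -- The only appeal to the initial assignment: index 16 passes over the sixteen earlier lemmas.
    -- All nonempty subsets of {4,5,6} and of {0,1,2,3} are members here, and the renaming
    -- identifies these with `Constr V₃ V₄`.
    (branch 15 (known 16 30841655964) (bound 1 6047)) (bound 1 1234331)) (bound 1 161928861))
    (bound 2 5655739833197745963)) (bound 1 3246339509655)) (bound 1 202066641046427))))) (bound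
    2 23557916512600487293222702720298)) (bound 1 7889684612053669404)))) (bound 2
    1918278162356499646429132178517892899622))) ∷
  given 25938363011 excluding 66 by branch 36 (known 1 50) (branch 18 (known 1 373) (branch 68
    (known 1 42) (branch 34 (known 1 6) (branch 20 (known 2 426) (branch 9 (branch 24 (known 2
    3411) (known 0 0)) (branch 6 (branch 65 (known 3 10) (branch 33 (known 3 394) (branch 24
    (known 0 15790927853651) (bound 2 7928665813543544368350230981783361047753)))) (branch 10
    (bound 2 3513266696985028283223297626688346229574) (bound 2
    53728453308513031665398488950657479705469718)))))))) ∷
  given 25938363011 excluding 0 by branch 66 (branch 36 (known 12 0) (known 2 0)) (known 0 0) ∷
  given 3316084507267 excluding 21626375174 by branch 68 (known 1 11218305689) (branch 66 (known
    1 89746445514) (branch 9 (bound 1 2302072393697504326) (bound 1 441799553557506140504))) ∷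
  given 25871123075 excluding 10246 by branch 24 (known 1 302) (branch 72 (known 1 4) (branch 33
    (branch 34 (bound 4 2391143878763569139057824252157742559202161825644693680977745124207192)
    (branch 36 (bound 4 2377874574517436481203399006155271311012595404488392386332968029955672)
    (bound 4 640990271684631295627545375159463374701264802661861280923502206124264720077656)))
    (branch 65 (known 0 0) (branch 9 (known 0 2988) (branch 17 (bound 4
    641000936248741630585552106094007497095967321437015771748814442336387443665993) (bound 2
    122932560316805565627737008311149871389378385)))))) ∷
  given 3311495479939 excluding 21559280774 by branch 10 (known 0 25) (branch 33 (bound 4
    1149517121785927987660039737313144490884694646534240691017477849255114) (bound 4
    306308407264397501166931123502293111737895252586648297713776806966955483501865)) ∷
  given 25870664323 excluding 168428678 by branch 34 (known 1 202) (branch 36 (known 0 0)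
    (branch 33 (known 0 1226) (branch 10 (bound 3
    30071616231205550643626155663468699416991450432590065308457) (bound 3
    67958480636064990280456624750750734899456883099130438103214482730)))) ∷
  given 202113667 excluding 80 by branch 6 (known 4 126317616248915) (branch 40 (known 2 0)
    (branch 9 (known 2 1010540929991321) (branch 12 (known 0 0) (branch 10 (known 0 2) (branch
    72 (known 0 1010540929991321) (branch 24 (known 0 5514140557361817) (bound 1
    13237481066174639780555790))))))) ∷
  given 202113667 excluding 0 by branch 80 (known 5 0) (known 0 0) ∷
  given 2486807134851 excluding 202642456 by branch 36 (known 0 154969) (branch 20 (known 1
    19353) (branch 12 (bound 4
    3441815691953179924453111342637907192566339996557944951822818023731796) (bound 2
    3762377872132469961875503378120225532444))) ∷
  given 19428557443 excluding 25938234374 by branch 66 (known 1 1690338) (branch 12 (known 1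
    14684) (branch 68 (known 2 211292) (branch 36 (bound 4
    510585476636899719839992066750028754949003748245935195933660473205845612898630) (bound 2
    62425416801964104178353537725302831404127844)))) ∷
  given 151782019 excluding 202642456 by branch 6 (branch 10 (known 1 0) (branch 34 (known 1
    421) (branch 18 (known 1 52) (branch 66 (known 1 19372) (bound 2
    59440711853502735074380091867005501601788186))))) (branch 33 (known 0 0) (branch 65 (known 0
    52) (branch 9 (known 0 372) (branch 17 (known 0 5) (bound 2
    2770502085603647806454585418688297817194874908881))))) ∷
  given 139199107 excluding 25938760728 by branch 20 (known 3 117657) (branch 36 (known 4
    941401) (branch 12 (known 0 941409) (bound 2
    2390701528068604906257766413543735518826977433116))) ∷
  given 787075 excluding 25938760728 by branch 66 (known 0 0) (branch 68 (known 0 2) (branch 12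
    (known 0 154978) (bound 2 26496124972214553829411138756968793209963388776034634))) ∷
  given 787075 excluding 1578008 by branch 80 (known 6 5) (branch 72 (known 2 0) (known 0 0)) ∷
  given 787075 excluding 12312 by branch 40 (known 7 2421) (known 0 0) ∷
  given 787075 excluding 0 by branch 96 (known 7 0) (branch 24 (known 7 302) (known 0 0)) ∷
  given 643 excluding 0 by branch 48 (known 0 0) (branch 72 (known 0 52) (branch 96 (known 1
    428) (branch 80 (known 2 3372) (branch 24 (known 2 302) (branch 40 (known 3 4) (branch 6
    (branch 36 (bound 2 2390796607754633654205318578300553910621501274168) (bound 2
    16792115864068962730000653223558443560264577116347480)) (bound 4
    4239322208983326487326243683830311760299942812022000493430888532328394716515644704985299998740090882556664884280)))))))
    ∷
  given 3 excluding 2242547712773 by branch 33 (known 0 229) (branch 66 (known 0 14705) (branch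
    17 (known 0 28) (branch 9 (known 0 3) (branch 40 (bound 3
    746180896418534861909976393689898740103214668066367870922485079516842893737361966817) (bound
    1 27689744534336029467334370612521))))) ∷
  given 3 excluding 559365 by branch 6 (known 1 1) (branch 65 (known 1 1838) (branch 10 (known 1
    25) (known 0 0))) ∷
  given 3 excluding 4357 by branch 18 (known 2 225) (known 0 0) ∷
  given 3 excluding 5 by branch 34 (known 3 1833) (known 0 0) ∷
  given 3 excluding 0 by branch 5 (known 4 0) (known 0 0) ∷
  []

-- The lemmas whose only required set is {0,1} settle, up to renaming, every case in which one of
-- the tried pairs is a member. In the final leaf the six pairs through the element 1, as well as
-- {2,3} and {3,4}, are absent, and counting clauses gives more than 15 sets.
proof₂ : Proof
proof₂ =
  branch 3 (known 0 0) (branch 24 (known 0 79955) (branch 12 (known 1 922826) (branch 6 (known 2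
  2833) (branch 66 (known 1 80241) (branch 34 (known 1 10025) (branch 18 (known 3 77936793)
  (branch 10 (known 4 1742033) (bound 1 2505715875543373414927915257595655))))))))

-- Lower bounds for the four levels

verified₄ : verify 4 0 (require {7} atMost1) [] [] (bound 1 127) ≡ true
-- The clause of `⊤` alone suffices: its entries, the larger parts of the splits, are distinct sets
-- of at least four elements.
verified₄ = refl

verified₃ : verify 3 5 (require {7} atMost1) [] lemmas₃ proof₃ ≡ true
verified₃ = refl

-- The codes 7 and 120 stand for {0,1,2} and {3,4,5,6}.
V₃ V₄ : Subset 7
V₃ = decode 7 7
V₄ = decode 7 120

verified₂ : verify 2 15 (require {7} atMost1) (require (Constr V₃ V₄) ∷ []) lemmas₂ proof₂ ≡ true
verified₂ = refl

module Absurd i B = Soundness i B {7} (λ _ → False) (λ _ _ ())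
module Extremal = Soundness 2 15 ContainsConstr ContainsConstr-swap

1≤card-^≥4 : ∀ {𝒢 : Family 7} → Splits 𝒢 → 1 ≤ card (𝒢 ^≥ 4)
1≤card-^≥4 {𝒢} split = ≰⇒> λ few →
  Absurd.verify-sound 4 0 (require atMost1) [] [] (bound 1 127) verified₄ 𝒢 (split , few)
    (⊨-require⁺ (atMost1⊆Splits split))

6≤card-^≥3 : ∀ {𝒢 : Family 7} → Splits 𝒢 → 6 ≤ card (𝒢 ^≥ 3)
6≤card-^≥3 {𝒢} split = ≰⇒> λ few →
  Absurd.verify-sound 3 5 (require atMost1) [] lemmas₃ proof₃ verified₃ 𝒢 (split , few)
    (⊨-require⁺ (atMost1⊆Splits split))

V₃V₄-partition : IsPartition₃₄ V₃ V₄
V₃V₄-partition = does⁻ (¬? (nonempty? (V₃ ∩ V₄))) tt , refl , refl , refl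

extremal : ∀ {𝒢} → Splits 𝒢 → card (𝒢 ^≥ 2) ≤ 15 → ContainsConstr 𝒢
extremal {𝒢} split few =
  Extremal.verify-sound (require atMost1) {require (Constr V₃ V₄) ∷ []} (settled ∷ [])
    lemmas₂ proof₂ verified₂ 𝒢 (split , few) (⊨-require⁺ (atMost1⊆Splits split))
  where
  settled : Extremal.Settled (require (Constr V₃ V₄))
  settled ℋ _ ℋ⊨ = V₃ , V₄ , V₃V₄-partition , ⊨-require⁻ ℋ⊨

-- A family below the bound would, by `extremal`, contain some `Constr V₁ V₂`, which already has 15
-- sets at this level.
15≤card-^≥2 : ∀ {𝒢 : Family 7} → Splits 𝒢 → 15 ≤ card (𝒢 ^≥ 2)
15≤card-^≥2 {𝒢} split = ≮⇒≥ λ few → <⇒≱ few (contains (extremal split (<⇒≤ few)))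
  where
  contains : ContainsConstr 𝒢 → 15 ≤ card (𝒢 ^≥ 2)
  contains (V₁ , V₂ , part , incl) = begin
    15
      ≡⟨ sym (card-Constr V₁ V₂ part 2 (≤ᵇ⇒≤ 3 5 tt)) ⟩
    card (Constr V₁ V₂ ^≥ 2)
      ≤⟨ card-mono {ℱ = Constr V₁ V₂ ^≥ 2} {𝒢 = 𝒢 ^≥ 2} (^≥-mono 2 incl) ⟩
    card (𝒢 ^≥ 2) ∎
    where open ≤-Reasoning

7+card-^≥2≤card-^≥1 : ∀ {𝒢 : Family 7} → Splits 𝒢 → 7 + card (𝒢 ^≥ 2) ≤ card (𝒢 ^≥ 1)
7+card-^≥2≤card-^≥1 {𝒢} split = begin
  7 + card (𝒢 ^≥ 2)                      ≡⟨ cong (7 +_) (card-^≥ 2 𝒢) ⟩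
  7 + weigh (large 2) 𝒢                  ≡⟨ cong (_+ weigh (large 2) 𝒢) (sym seven) ⟩
  weigh singletons 𝒢 + weigh (large 2) 𝒢 ≡⟨ sym (weigh-+ singletons (large 2) 𝒢) ⟩
  weigh both 𝒢                           ≤⟨ weigh-mono both (large 1) (from T-≡ light) 𝒢 ⟩
  weigh (large 1) 𝒢                      ≡⟨ sym (card-^≥ 1 𝒢) ⟩
  card (𝒢 ^≥ 1)                          ∎
  where
  open ≤-Reasoning

  singletons both : Trie ℕ 7
  -- Weight one on exactly the singletons: `∅` is required as well, but `large 1` gives it weight 0.
  singletons = forced 1 1 (require atMost1)
  both       = zipTrie _+_ singletons (large 2)

  light : all₂ _≤ᵇ_ both (large 1) ≡ true
  light = refl

  seven : weigh singletons 𝒢 ≡ 7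
  seven = weigh-forced 1 (require atMost1) (large 1) (⊨-require⁺ (atMost1⊆Splits split))

-- Optimality and uniqueness

constrSize≤ : ∀ {𝒢} → IsGenerator 7 2 𝒢 → ∀ i → 1 ≤ i → i ≤ 4 →
              constrSize i ≤ card (𝒢 ^≥ i)
constrSize≤ {𝒢} gen (suc i) _ i≤4 =
  subst (constrSize (suc i) ≤_) (card-withEmpty i 𝒢) (bounds i i≤4)
  where
  split : Splits (withEmpty 𝒢)
  split = generator⇒Splits gen

  bounds : ∀ i → suc i ≤ 4 → constrSize (suc i) ≤ card (withEmpty 𝒢 ^≥ suc i)
  -- The value 22 arises as 7 + 15: singletons plus the larger sets.
  bounds 0 _ = ≤-trans (+-monoʳ-≤ 7 (15≤card-^≥2 split)) (7+card-^≥2≤card-^≥1 split)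
  bounds 1 _ = 15≤card-^≥2 split
  bounds 2 _ = 6≤card-^≥3 split
  bounds 3 _ = 1≤card-^≥4 split
  bounds (suc (suc (suc (suc _)))) (s≤s (s≤s (s≤s (s≤s ()))))

card-Constr≡22 : ∀ V₁ V₂ → IsPartition₃₄ V₁ V₂ → card (Constr V₁ V₂) ≡ 22
card-Constr≡22 V₁ V₂ part =
  trans (card-cong {𝒢 = Constr V₁ V₂} {ℋ = Constr V₁ V₂ ^≥ 0}
          (λ g → sym (∧-identityʳ (Constr V₁ V₂ g))))
        (card-Constr V₁ V₂ part 0 (s≤s z≤n))

Constr-optimal : ∀ V₁ V₂ → IsPartition₃₄ V₁ V₂ → IsOptimalGenerator 7 2 (Constr V₁ V₂)
Constr-optimal V₁ V₂ part@(disj , cover , _) = Constr-generator disj cover , λ ℋ gen → begin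
  card (Constr V₁ V₂)  ≡⟨ card-Constr≡22 V₁ V₂ part ⟩
  22                   ≤⟨ constrSize≤ gen 1 ≤-refl (s≤s z≤n) ⟩
  card (ℋ ^≥ 1)        ≤⟨ card-mono {ℱ = ℋ ^≥ 1} {𝒢 = ℋ} (^≥-⊆ᶠ 1 ℋ) ⟩
  card ℋ               ∎
  where open ≤-Reasoning

-- Comparison with one `Constr` gives at most 22 members, and the singletons leave at most 15 larger
-- ones. Hence `extremal` provides an included `Constr V₁ V₂`, whose 22 members exhaust `𝒢`.
optimal-unique : ∀ 𝒢 → IsOptimalGenerator 7 2 𝒢 →
                 ∃[ V₁ ] ∃[ V₂ ] IsPartition₃₄ V₁ V₂ × 𝒢 ≗ Constr V₁ V₂
optimal-unique 𝒢 (gen , minimal) =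
  let V₁ , V₂ , part , incl = extremal {withEmpty 𝒢} split few in
  V₁ , V₂ , part , ⊆ᶠ∧card≥⇒≗ {ℱ = Constr V₁ V₂} {𝒢 = 𝒢}
    -- The inclusion is known for `withEmpty 𝒢`; it descends to `𝒢` because the members of
    -- `Constr V₁ V₂` are nonempty.
    (λ g g∈ → withEmpty-nonempty {𝒢 = 𝒢} g (Constr-nonempty V₁ V₂ g g∈) (incl g g∈))
    (≤-trans card≤22 (≤-reflexive (sym (card-Constr≡22 V₁ V₂ part))))
  where
  split : Splits (withEmpty 𝒢)
  split = generator⇒Splits gen

  card≤22 : card 𝒢 ≤ 22
  card≤22 = ≤-trans (minimal (Constr V₃ V₄) (proj₁ (Constr-optimal V₃ V₄ V₃V₄-partition)))
                    (≤-reflexive (card-Constr≡22 V₃ V₄ V₃V₄-partition))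

  few : card (withEmpty 𝒢 ^≥ 2) ≤ 15
  few = +-cancelˡ-≤ 7 (card (withEmpty 𝒢 ^≥ 2)) 15 (begin
    7 + card (withEmpty 𝒢 ^≥ 2) ≤⟨ 7+card-^≥2≤card-^≥1 {withEmpty 𝒢} split ⟩
    card (withEmpty 𝒢 ^≥ 1)     ≡⟨ card-withEmpty 0 𝒢 ⟩
    card (𝒢 ^≥ 1)               ≤⟨ card-mono {ℱ = 𝒢 ^≥ 1} {𝒢 = 𝒢} (^≥-⊆ᶠ 1 𝒢) ⟩
    card 𝒢                      ≤⟨ card≤22 ⟩
    22                          ∎)
    where open ≤-Reasoning

theorem8 :
  (∀ 𝒢 → IsGenerator 7 2 𝒢 →
    ∀ V₁ V₂ → IsPartition₃₄ V₁ V₂ →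
    ∀ i → 1 ≤ i → i ≤ 4 → card (𝒢 ^≥ i) ≥ card (Constr V₁ V₂ ^≥ i))
  × (∀ 𝒢 → IsOptimalGenerator 7 2 𝒢 →
      ∃[ V₁ ] ∃[ V₂ ] IsPartition₃₄ V₁ V₂ × 𝒢 ≗ Constr V₁ V₂)
  × (∀ V₁ V₂ → IsPartition₃₄ V₁ V₂ → IsOptimalGenerator 7 2 (Constr V₁ V₂))
theorem8 =
  (λ 𝒢 gen V₁ V₂ part i 1≤i i≤4 →
    ≤-trans (≤-reflexive (card-Constr V₁ V₂ part i (s≤s i≤4))) (constrSize≤ gen i 1≤i i≤4)) ,
  optimal-unique ,
  Constr-optimal
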